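{- For any integer $n \geq 0$ (with $a$ denoting a nonnegative integer), $$v_2(B_n(4,0)) = \begin{cases} 0, & \text{if } n \equiv 0 \pmod{5}, \\ 1 + 2 v_2(a), & \text{if } n=5a + 1 \text{ and } v_2(a) \leq 2, \\ 1+ v_2\big(a(a+1)\big), & \text{if } n=5a + 2 \text{ and } v_2\big(a(a+1)\big) \leq 5, \\ 3, & \text{if } n=5a + 3 \text{ and } v_2(a+3) \geq 2, \\ 0, & \text{if } n \equiv 4 \pmod{5}. \end{cases}$$ (No assertion is made for values of $n$ not covered by these cases.)
   Context: The sequence $\{B_n(4,0)\}_{n\geq 0}$ is defined by $B_n = B_{n-1}+B_{n-2}+B_{n-3}+B_{n-4}$ for $n \geq 4$, with $(B_0,B_1,B_2,B_3)=(1,0,0,0)$. $v_2$ denotes the 2-adic order (2-adic valuation), with the convention $v_2(0)=+\infty$. -}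

module Defs where

open import Data.Bool.Base using (if_then_else_)
open import Data.Nat.Base
open import Data.Nat.Divisibility using (_∣_; _∣?_; _∣0; 1∣_; ∣⇒≤; ∣-trans; m∣m*n)
open import Data.Nat.Properties
open import Function.Bundles using (_⇔_; mk⇔)
open import Relation.Binary.Construct.Add.Supremum.NonStrict _≤_ using (_≤⁺_; [_]; _≤⊤⁺)
open import Relation.Binary.PropositionalEquality using (refl; subst; trans; sym; cong)
open import Relation.Nullary.Construct.Add.Supremum using (_⁺; ⊤⁺; [_])
open import Relation.Nullary.Decidable using (does; yes; no)
open import Relation.Nullary.Negation using (contradiction)

B : ℕ → ℕ
B 0 = 1
B 1 = 0
B 2 = 0
B 3 = 0
B (suc (suc (suc (suc n)))) =
  B (suc (suc (suc n))) + B (suc (suc n)) + B (suc n) + B n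

-- The greatest k ≤ b such that 2 ^ k ∣ n.
maxExponent : (b n : ℕ) → ℕ
maxExponent zero    n = 0
maxExponent (suc b) n = if does (2 ^ suc b ∣? n) then suc b else maxExponent b n

-- For n > 0, 2 ^ k ∣ n forces k < 2 ^ k ≤ n, so searching up to n suffices.
v₂ : ℕ → ℕ ⁺
v₂ zero      = ⊤⁺
v₂ n@(suc _) = [ maxExponent n n ]

maxExponent-∣ : ∀ b n → 2 ^ maxExponent b n ∣ n
maxExponent-∣ zero    n = 1∣ n
maxExponent-∣ (suc b) n with 2 ^ suc b ∣? n
... | yes p = p
... | no  _ = maxExponent-∣ b n

maxExponent-max : ∀ b n {k} → k ≤ b → 2 ^ k ∣ n → k ≤ maxExponent b n
maxExponent-max zero    n k≤b _ = k≤b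
maxExponent-max (suc b) n {k} k≤b 2^k∣n with 2 ^ suc b ∣? n
... | yes _ = k≤b
... | no ¬p with k ≟ suc b
...   | yes refl = contradiction 2^k∣n ¬p
...   | no k≢1+b = maxExponent-max b n (s≤s⁻¹ (≤∧≢⇒< k≤b k≢1+b)) 2^k∣n

k<2^k : ∀ k → k < 2 ^ k
k<2^k zero    = s≤s z≤n
k<2^k (suc k) = +-mono-≤ (m^n>0 2 k) (≤-trans (k<2^k k) (m≤m+n _ 0))

2^-mono-∣ : ∀ {k l} → k ≤ l → 2 ^ k ∣ 2 ^ l
2^-mono-∣ {k} {l} k≤l = subst (2 ^ k ∣_)
  (trans (sym (^-distribˡ-+-* 2 k (l ∸ k))) (cong (2 ^_) (m+[n∸m]≡n k≤l)))
  (m∣m*n (2 ^ (l ∸ k)))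

v₂-spec : ∀ k n → [ k ] ≤⁺ v₂ n ⇔ 2 ^ k ∣ n
v₂-spec k zero      = mk⇔ (λ _ → _ ∣0) (λ _ → _ ≤⊤⁺)
v₂-spec k n@(suc _) = mk⇔
  (λ { [ k≤v ] → ∣-trans (2^-mono-∣ k≤v) (maxExponent-∣ n n) })
  (λ 2^k∣n → [ maxExponent-max n n (<⇒≤ (<-≤-trans (k<2^k k) (∣⇒≤ 2^k∣n))) 2^k∣n ])

-- Modulo 128 = 2 ^ 7 the sequence B is purely periodic with period 320 = 5 * 64.
-- Every asserted order is at most 6, hence visible modulo 128, and every
-- hypothesis on a depends only on a modulo 64; so each clause is a finite check
-- over the 64 residues of a.
module Submission where

open import Defs
open import Data.Maybe.Base using (map)
open import Data.Nat.Base using (ℕ; zero; suc; _+_; _*_; _^_; _≤_; _<_; s≤s; NonZero)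
open import Data.Nat.DivMod
  using (_%_; _/_; m≡m%n+[m/n]*n; m%n<n; m%n%n≡m%n; %-distribˡ-+; %-distribˡ-*)
open import Data.Nat.Divisibility using (_∣_; _∤_; _∣?_; %-presˡ-∣; ∣n∣m%n⇒∣m)
open import Data.Nat.Properties
open import Data.Nat.Tactic.RingSolver using (solve)
open import Data.List.Base using ([]; _∷_)
open import Data.Product.Base using (_×_; _,_; proj₁; proj₂)
open import Function.Bundles using (module Equivalence)
open import Relation.Binary.Construct.Add.Supremum.NonStrict _≤_ using (_≤⁺_; [_])
open import Relation.Binary.PropositionalEquality
open import Relation.Nullary.Construct.Add.Supremum using (⊤⁺; [_])
open import Relation.Nullary.Decidable using (Dec; from-yes; ¬?; _×-dec_; _→-dec_)
open import Relation.Nullary.Negation using (contradiction)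

-- Exact divisibility stands in for `v₂ n ≡ [ k ]`: it is decidable by two divisibility tests and,
-- unlike `v₂` itself, transfers along congruences.
2^_∥_ : ℕ → ℕ → Set
2^ k ∥ n = 2 ^ k ∣ n × 2 ^ suc k ∤ n

2^_∥?_ : ∀ k n → Dec (2^ k ∥ n)
2^ k ∥? n = (2 ^ k ∣? n) ×-dec ¬? (2 ^ suc k ∣? n)

∥⇒v₂≡ : ∀ {k n} → 2^ k ∥ n → v₂ n ≡ [ k ]
∥⇒v₂≡ {k} {n} (2^k∣n , 2^1+k∤n)
  with v₂ n | Equivalence.from (v₂-spec k n) 2^k∣n | Equivalence.to (v₂-spec (suc k) n)
... | ⊤⁺    | _       | ≤v⇒∣ = contradiction (≤v⇒∣ (_ _≤⁺_.≤⊤⁺)) 2^1+k∤n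
... | [ v ] | [ k≤v ] | ≤v⇒∣ =
  cong [_] (≤-antisym (≮⇒≥ λ k<v → 2^1+k∤n (≤v⇒∣ [ k<v ])) k≤v)

v₂≡⇒∥ : ∀ {k n} → v₂ n ≡ [ k ] → 2^ k ∥ n
v₂≡⇒∥ {k} {n} v≡k =
    Equivalence.to (v₂-spec k n) (subst ([ k ] ≤⁺_) (sym v≡k) [ ≤-refl ])
  , λ 2^1+k∣n → [1+k]≰[k] (subst ([ suc k ] ≤⁺_) v≡k (Equivalence.from (v₂-spec (suc k) n) 2^1+k∣n))
  where
  [1+k]≰[k] : [ suc k ] ≤⁺ [ k ] → _
  [1+k]≰[k] [ 1+k≤k ] = 1+n≰n 1+k≤k

infix 4 _≡_[mod_]

-- A record, because m and n cannot be inferred from m % d ≡ n % d, where % unfolds.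
record _≡_[mod_] (m n d : ℕ) .{{_ : NonZero d}} : Set where
  constructor mod
  field %≡% : m % d ≡ n % d
open _≡_[mod_]

mod-sym : ∀ {d m n} .{{_ : NonZero d}} → m ≡ n [mod d ] → n ≡ m [mod d ]
mod-sym (mod p) = mod (sym p)

mod-refl : ∀ {d m} .{{_ : NonZero d}} → m ≡ m [mod d ]
mod-refl = mod refl

%-mod : ∀ m d .{{_ : NonZero d}} → m % d ≡ m [mod d ]
%-mod m d = mod (m%n%n≡m%n m d)

+-cong-mod : ∀ {d m m′ n n′} .{{_ : NonZero d}} →
             m ≡ m′ [mod d ] → n ≡ n′ [mod d ] → m + n ≡ m′ + n′ [mod d ]
+-cong-mod {d} {m} {m′} {n} {n′} (mod p) (mod q) = mod
  (trans (%-distribˡ-+ m n d)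
    (trans (cong₂ (λ x y → (x + y) % d) p q) (sym (%-distribˡ-+ m′ n′ d))))

*-cong-mod : ∀ {d m m′ n n′} .{{_ : NonZero d}} →
             m ≡ m′ [mod d ] → n ≡ n′ [mod d ] → m * n ≡ m′ * n′ [mod d ]
*-cong-mod {d} {m} {m′} {n} {n′} (mod p) (mod q) = mod
  (trans (%-distribˡ-* m n d)
    (trans (cong₂ (λ x y → (x * y) % d) p q) (sym (%-distribˡ-* m′ n′ d))))

∣-cong-mod : ∀ {d b m n} .{{_ : NonZero b}} → d ∣ b → m ≡ n [mod b ] → d ∣ m → d ∣ n
∣-cong-mod {d} d∣b (mod m≡n) d∣m =
  ∣n∣m%n⇒∣m d∣b (subst (d ∣_) m≡n (%-presˡ-∣ d∣m d∣b))

-- The bound on `k` is strict because `2 ^ suc k`, not just `2 ^ k`, has to divide the modulus for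
-- non-divisibility to transfer.
∥-cong-mod : ∀ {k m n} b .{{_ : NonZero (2 ^ b)}} → k < b →
             m ≡ n [mod 2 ^ b ] → 2^ k ∥ m → 2^ k ∥ n
∥-cong-mod b k<b m≡n (2^k∣m , 2^1+k∤m) =
    ∣-cong-mod (2^-mono-∣ (<⇒≤ k<b)) m≡n 2^k∣m
  , λ 2^1+k∣n → 2^1+k∤m (∣-cong-mod (2^-mono-∣ k<b) (mod-sym m≡n) 2^1+k∣n)

Window : Set
Window = ℕ × ℕ × ℕ × ℕ

-- Four consecutive residues determine the next one, so the recurrence becomes the iteration of a
-- map on states.
shift : Window → Window
shift (w , x , y , z) = x , y , z , (z + y + x + w) % 128

-- Unlike B itself, this takes linear time to evaluate.
window : ℕ → Window
window zero    = 1 , 0 , 0 , 0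
window (suc n) = shift (window n)

B%128 : ℕ → ℕ
B%128 n = proj₁ (window n)

window-B : ∀ n → window n ≡
  (B n % 128 , B (1 + n) % 128 , B (2 + n) % 128 , B (3 + n) % 128)
window-B zero    = refl
window-B (suc n) = trans (cong shift (window-B n))
  (cong (λ x → B (1 + n) % 128 , B (2 + n) % 128 , B (3 + n) % 128 , x)
    (%≡% (+-cong-mod (+-cong-mod (+-cong-mod (red (3 + n)) (red (2 + n))) (red (1 + n))) (red n))))
  where
  red : ∀ m → B m % 128 ≡ B m [mod 128 ]
  red m = %-mod (B m) 128

-- Equal states have equal futures, since `window` is an orbit of `shift`.
window-+ : ∀ m k l → window k ≡ window l → window (m + k) ≡ window (m + l)
window-+ zero    k l eq = eq
window-+ (suc m) k l eq = cong shift (window-+ m k l eq)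

window-q*320 : ∀ q → window (q * 320) ≡ window 0
window-q*320 zero    = refl
window-q*320 (suc q) = trans (window-+ 320 (q * 320) 0 (window-q*320 q)) window-320
  where
  window-320 : window 320 ≡ window 0
  -- The period is verified by evaluating 320 shifts.
  window-320 = refl

window-periodic : ∀ m q → window (m + q * 320) ≡ window m
window-periodic m q =
  trans (window-+ m (q * 320) 0 (window-q*320 q)) (cong window (+-identityʳ m))

-- Writing `a` as `r + q * 64` moves the index by `q * 320`, a whole number of periods, so only `r`
-- matters.
B-residue : ∀ a c → B (5 * a + c) % 128 ≡ B%128 (5 * (a % 64) + c)
B-residue a c = begin
  B (5 * a + c) % 128                               ≡⟨ cong proj₁ (window-B (5 * a + c)) ⟨
  B%128 (5 * a + c)                                 ≡⟨ cong B%128 split ⟩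
  B%128 (5 * (a % 64) + c + a / 64 * 320)           ≡⟨ cong proj₁ (window-periodic (5 * (a % 64) + c) (a / 64)) ⟩
  B%128 (5 * (a % 64) + c)                          ∎
  where
  open ≡-Reasoning
  rearrange : ∀ r q → 5 * (r + q * 64) + c ≡ 5 * r + c + q * 320
  rearrange r q = solve (r ∷ q ∷ c ∷ [])
  split : 5 * a + c ≡ 5 * (a % 64) + c + a / 64 * 320
  split = trans (cong (λ x → 5 * x + c) (m≡m%n+[m/n]*n a 64)) (rearrange (a % 64) (a / 64))

v₂-B : ∀ {k} a c → k < 7 → 2^ k ∥ B%128 (5 * (a % 64) + c) → v₂ (B (5 * a + c)) ≡ [ k ]
v₂-B a c k<7 h = ∥⇒v₂≡ (∥-cong-mod 7 k<7
  (subst (_≡ B (5 * a + c) [mod 128 ]) (B-residue a c) (%-mod (B (5 * a + c)) 128)) h)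

-- In this and the following checks, `from-yes` makes the type checker run the decision procedure
-- over all residues `r`.
check₀ : ∀ {r} → r < 64 → 2^ 0 ∥ B%128 (5 * r + 0)
check₀ = from-yes (allUpTo? (λ r → 2^ 0 ∥? B%128 (5 * r + 0)) 64)

check₁ : ∀ {k} → k < 3 → ∀ {r} → r < 64 → 2^ k ∥ r → 2^ (1 + 2 * k) ∥ B%128 (5 * r + 1)
check₁ = from-yes (allUpTo? (λ k → allUpTo? (λ r →
  (2^ k ∥? r) →-dec (2^ (1 + 2 * k) ∥? B%128 (5 * r + 1))) 64) 3)

-- The extreme case `k = 5` dictates both moduli: the hypothesis tests divisibility by `2 ^ 6 = 64`,
-- the conclusion by `2 ^ 7 = 128`.
check₂ : ∀ {k} → k < 6 → ∀ {r} → r < 64 →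
         2^ k ∥ (r * (r + 1)) → 2^ (1 + k) ∥ B%128 (5 * r + 2)
check₂ = from-yes (allUpTo? (λ k → allUpTo? (λ r →
  (2^ k ∥? (r * (r + 1))) →-dec (2^ (1 + k) ∥? B%128 (5 * r + 2))) 64) 6)

check₃ : ∀ {r} → r < 64 → 4 ∣ r + 3 → 2^ 3 ∥ B%128 (5 * r + 3)
check₃ = from-yes (allUpTo? (λ r → (4 ∣? r + 3) →-dec (2^ 3 ∥? B%128 (5 * r + 3))) 64)

check₄ : ∀ {r} → r < 64 → 2^ 0 ∥ B%128 (5 * r + 4)
check₄ = from-yes (allUpTo? (λ r → 2^ 0 ∥? B%128 (5 * r + 4)) 64)

≡5*[n/5]+c : ∀ n {c} → n % 5 ≡ c → 5 * (n / 5) + c ≡ n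
≡5*[n/5]+c n refl = begin
  5 * (n / 5) + n % 5  ≡⟨ +-comm (5 * (n / 5)) (n % 5) ⟩
  n % 5 + 5 * (n / 5)  ≡⟨ cong (n % 5 +_) (*-comm 5 (n / 5)) ⟩
  n % 5 + n / 5 * 5    ≡⟨ m≡m%n+[m/n]*n n 5 ⟨
  n                    ∎
  where open ≡-Reasoning

%64<64 : ∀ a → a % 64 < 64
%64<64 a = m%n<n a 64

≡%64 : ∀ a → a ≡ a % 64 [mod 64 ]
≡%64 a = mod-sym (%-mod a 64)

v₂-B-5a+1 : ∀ a → v₂ a ≤⁺ [ 2 ] → v₂ (B (5 * a + 1)) ≡ map (λ v → 1 + 2 * v) (v₂ a)
v₂-B-5a+1 a v≤2 with v₂ a in eq | v≤2
-- The value `⊤⁺` is not below `[ 2 ]`, which rules out `a = 0`. The order `1 + 2 * k` is at most 5,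
-- hence below 7.
... | [ k ] | [ k≤2 ] = v₂-B a 1 (s≤s (≤-trans (s≤s (*-monoʳ-≤ 2 k≤2)) (n≤1+n 5)))
  (check₁ (s≤s k≤2) (%64<64 a)
    (∥-cong-mod 6 (≤-trans (s≤s k≤2) (m≤m+n 3 3)) (≡%64 a) (v₂≡⇒∥ eq)))

v₂-B-5a+2 : ∀ a → v₂ (a * (a + 1)) ≤⁺ [ 5 ] →
            v₂ (B (5 * a + 2)) ≡ map (λ v → 1 + v) (v₂ (a * (a + 1)))
v₂-B-5a+2 a v≤5 with v₂ (a * (a + 1)) in eq | v≤5
... | [ k ] | [ k≤5 ] = v₂-B a 2 (s≤s (s≤s k≤5))
  (check₂ (s≤s k≤5) (%64<64 a)
    -- The hypothesis is carried from `a` to `a % 64`; exactness at `k ≤ 5` survives reduction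
    -- modulo `2 ^ 6`.
    (∥-cong-mod 6 (s≤s k≤5)
      (*-cong-mod (≡%64 a) (+-cong-mod (≡%64 a) mod-refl)) (v₂≡⇒∥ eq)))

v₂-B-5a+3 : ∀ a → [ 2 ] ≤⁺ v₂ (a + 3) → v₂ (B (5 * a + 3)) ≡ [ 3 ]
v₂-B-5a+3 a 2≤v = v₂-B a 3 (m≤m+n 4 3)
  (check₃ (%64<64 a)
    -- The hypothesis is only a lower bound on the order, so plain divisibility by 4 is transferred,
    -- using that 4 divides 64.
    (∣-cong-mod (2^-mono-∣ {2} {6} (m≤m+n 2 4)) (+-cong-mod (≡%64 a) mod-refl)
      (Equivalence.to (v₂-spec 2 (a + 3)) 2≤v)))

theorem13 : ∀ (n : ℕ) →
    (n % 5 ≡ 0 → v₂ (B n) ≡ [ 0 ])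
    × (∀ (a : ℕ) → n ≡ 5 * a + 1 → v₂ a ≤⁺ [ 2 ] →
    v₂ (B n) ≡ map (λ v → 1 + 2 * v) (v₂ a))
    × (∀ (a : ℕ) → n ≡ 5 * a + 2 → v₂ (a * (a + 1)) ≤⁺ [ 5 ] →
    v₂ (B n) ≡ map (λ v → 1 + v) (v₂ (a * (a + 1))))
    × (∀ (a : ℕ) → n ≡ 5 * a + 3 → [ 2 ] ≤⁺ v₂ (a + 3) →
    v₂ (B n) ≡ [ 3 ])
    × (n % 5 ≡ 4 → v₂ (B n) ≡ [ 0 ])
theorem13 n =
    -- The clauses on `n % 5` name no `a`; the quotient `n / 5` takes its place.
    (λ n%5≡0 → subst (λ m → v₂ (B m) ≡ [ 0 ]) (≡5*[n/5]+c n n%5≡0)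
      (v₂-B (n / 5) 0 (m≤m+n 1 6) (check₀ (%64<64 (n / 5)))))
  , (λ { a refl → v₂-B-5a+1 a })
  , (λ { a refl → v₂-B-5a+2 a })
  , (λ { a refl → v₂-B-5a+3 a })
  , (λ n%5≡4 → subst (λ m → v₂ (B m) ≡ [ 0 ]) (≡5*[n/5]+c n n%5≡4)
      (v₂-B (n / 5) 4 (m≤m+n 1 6) (check₄ (%64<64 (n / 5)))))
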